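{- Let $A \subseteq \omega$ be a computably enumerable set such that $A <_T \emptyset'$. Let $\delta$ be a partial $A$-computable function from $\omega$ to $\omega$ that is fixed point free, i.e. for every $n$, if $\delta(n)\downarrow$ then $W_{\delta(n)} \neq W_n$. Then for every partial computable function $\psi$ from $\omega$ to $\omega$ there exists a (total) computable function $f : \omega \to \omega$ such that for every $n \in \omega$: \begin{align*} \psi(n)\downarrow \; &\Longrightarrow \; W_{f(n)} = W_{\psi(n)},\\ \psi(n)\uparrow \; &\Longrightarrow \; \delta(f(n))\uparrow. \end{align*}
   Context: $\omega$ denotes the set of natural numbers. $\varphi_e$ denotes the $e$-th partial computable function in a fixed standard (acceptable) numbering of the unary partial computable functions, and $W_e = \mathrm{dom}(\varphi_e)$ is the $e$-th computably enumerable set. For a partial function $\alpha$, $\alpha(n)\downarrow$ means that $\alpha$ is defined at $n$, and $\alpha(n)\uparrow$ that it is undefined at $n$. $\emptyset'$ is the halting set. $A <_T \emptyset'$ means $A \leq_T \emptyset'$ and $\emptyset' \not\leq_T A$, where $\leq_T$ is Turing reducibility. A partial function is partial $A$-computable if it is computed by an oracle Turing machine with oracle $A$. -}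

module Defs where

open import Data.Empty using (⊥; ⊥-elim)
open import Data.Fin using (Fin)
open import Data.Nat using (ℕ; zero; suc; _<_)
open import Data.Product using (Σ; ∃; _×_; _,_)
open import Data.Unit using (⊤)
open import Data.Vec using (Vec; []; _∷_; [_]; lookup)
open import Data.Vec.Relation.Binary.Pointwise.Inductive using (Pointwise)
open import Function.Bundles using (_⇔_)
open import Level using (0ℓ)
open import Relation.Binary.PropositionalEquality using (_≡_; refl; sym; trans)
open import Relation.Nullary using (¬_; contradiction)
open import Relation.Unary using (Pred; _≐_)

-- Partial functions ℕᵏ ⇀ ℕ are single-valued relations, so that divergence
-- need not be decidable.
record Partial (k : ℕ) : Set₁ where
  field
    graph      : Vec ℕ k → ℕ → Set
    functional : ∀ {xs y z} → graph xs y → graph xs z → y ≡ z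

open Partial public

infix 4 _⟨_⟩≃_ _⟨_⟩↓ _⟨_⟩↑

_⟨_⟩≃_ : Partial 1 → ℕ → ℕ → Set
α ⟨ n ⟩≃ m = graph α [ n ] m

_⟨_⟩↓ : Partial 1 → ℕ → Set
α ⟨ n ⟩↓ = ∃ λ m → α ⟨ n ⟩≃ m

_⟨_⟩↑ : Partial 1 → ℕ → Set
α ⟨ n ⟩↑ = ¬ (α ⟨ n ⟩↓)

total : (ℕ → ℕ) → Partial 1
total f = record
  { graph      = λ { (x ∷ []) y → f x ≡ y }
  ; functional = λ { {_ ∷ []} p q → trans (sym p) q }
  }

data CharGraph (A : Pred ℕ 0ℓ) (x : ℕ) : ℕ → Set where
  inside  : A x → CharGraph A x 1
  outside : ¬ A x → CharGraph A x 0

χ : Pred ℕ 0ℓ → Partial 1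
χ A = record
  { graph      = λ { (x ∷ []) y → CharGraph A x y }
  ; functional = λ { {_ ∷ []} → unique }
  }
  where
  unique : ∀ {x y z} → CharGraph A x y → CharGraph A x z → y ≡ z
  unique (inside _)  (inside _)  = refl
  unique (inside a)  (outside b) = contradiction a b
  unique (outside b) (inside a)  = contradiction a b
  unique (outside _) (outside _) = refl

-- Programs for Kleene's partial recursive functions of arity k, relative to a
-- family of oracle sets indexed by I.
data Code (I : Set) : ℕ → Set where
  zer   : ∀ {k} → Code I k
  succ  : Code I 1
  proj  : ∀ {k} → Fin k → Code I k
  query : I → Code I 1
  comp  : ∀ {k m} → Code I m → Vec (Code I k) m → Code I k
  prec  : ∀ {k} → Code I k → Code I (suc (suc k)) → Code I (suc k)
  mu    : ∀ {k} → Code I (suc k) → Code I k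

-- Eval O c xs y : with oracles O, the program c halts on xs with output y.
data Eval {I : Set} (O : I → Pred ℕ 0ℓ) : ∀ {k} → Code I k → Vec ℕ k → ℕ → Set where
  ev-zer   : ∀ {k} {xs : Vec ℕ k} → Eval O zer xs 0
  ev-succ  : ∀ {x} → Eval O succ [ x ] (suc x)
  ev-proj  : ∀ {k} {i : Fin k} {xs} → Eval O (proj i) xs (lookup xs i)
  ev-query : ∀ {i x y} → CharGraph (O i) x y → Eval O (query i) [ x ] y
  ev-comp  : ∀ {k m} {g : Code I m} {hs : Vec (Code I k) m} {xs ys z} →
             Pointwise (λ h y → Eval O h xs y) hs ys →
             Eval O g ys z → Eval O (comp g hs) xs z
  ev-prec0 : ∀ {k} {g : Code I k} {h xs z} →
             Eval O g xs z → Eval O (prec g h) (0 ∷ xs) z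
  ev-precs : ∀ {k} {g : Code I k} {h xs n r z} →
             Eval O (prec g h) (n ∷ xs) r →
             Eval O h (n ∷ r ∷ xs) z → Eval O (prec g h) (suc n ∷ xs) z
  ev-mu    : ∀ {k} {g : Code I (suc k)} {xs n} →
             Eval O g (n ∷ xs) 0 →
             (∀ {i} → i < n → ∃ λ v → Eval O g (i ∷ xs) (suc v)) →
             Eval O (mu g) xs n

PartialComputable : ∀ {k} → Partial k → Set
PartialComputable {k} α =
  Σ (Code ⊥ k) λ c → ∀ xs y → graph α xs y ⇔ Eval ⊥-elim c xs y

PartialComputableIn : ∀ {k} → Pred ℕ 0ℓ → Partial k → Set
PartialComputableIn {k} A α =
  Σ (Code ⊤ k) λ c → ∀ xs y → graph α xs y ⇔ Eval (λ _ → A) c xs y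

Computable : (ℕ → ℕ) → Set
Computable f = PartialComputable (total f)

infix 4 _≤T_ _<T_

_≤T_ : Pred ℕ 0ℓ → Pred ℕ 0ℓ → Set
A ≤T B = PartialComputableIn B (χ A)

_<T_ : Pred ℕ 0ℓ → Pred ℕ 0ℓ → Set
A <T B = A ≤T B × ¬ (B ≤T A)

Numbering : Set₁
Numbering = ℕ → Partial 1

universal : Numbering → Partial 2
universal φ = record
  { graph      = λ { (e ∷ xs) y → graph (φ e) xs y }
  ; functional = λ { {e ∷ _} → functional (φ e) }
  }

-- A numbering of the unary partial computable functions is acceptable when it
-- satisfies the enumeration and s-m-n properties. Enumeration makes each φ e
-- partial computable; s-m-n, applied to a function ignoring its parameter,
-- shows that every unary partial computable function occurs.
record Acceptable (φ : Numbering) : Set₁ where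
  field
    enumeration : PartialComputable (universal φ)
    s-m-n       : (α : Partial 2) → PartialComputable α →
                  ∃ λ (s : ℕ → ℕ) → Computable s ×
                    (∀ e x y → φ (s e) ⟨ x ⟩≃ y ⇔ graph α (e ∷ x ∷ []) y)

module _ (φ : Numbering) where

  W : ℕ → Pred ℕ 0ℓ
  W e x = φ e ⟨ x ⟩↓

  ComputablyEnumerable : Pred ℕ 0ℓ → Set
  ComputablyEnumerable A = ∃ λ e → A ≐ W e

  ∅′ : Pred ℕ 0ℓ
  ∅′ e = φ e ⟨ e ⟩↓

  FixedPointFree : Partial 1 → Set
  FixedPointFree δ = ∀ n m → δ ⟨ n ⟩≃ m → ¬ (W m ≐ W n)

{-# OPTIONS --safe #-}

-- Write K = ∅′. The recursion theorem yields a computable f k n whose set W (f k n)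
-- copies, at the first stage where this is permitted, either W (ψ n) or the current
-- approximation to W (δ (f k n)). The former is permitted once ψ n has halted and the
-- computation of δ (f k n) present when it halted has been destroyed by a change of A;
-- the latter once k has entered K and δ (f k n) appears to converge.
--
-- Suppose that at some stage δ (f k n) converges by a computation that is correct for A,
-- and nothing has been copied yet. If k entered K later, W (f k n) would copy
-- W (δ (f k n)), which is impossible as δ is fixed point free. So such a stage certifies
-- k ∉ K. If k ∉ K and f k is not as required, such a stage exists: either δ (f k n)
-- converges while ψ n diverges, or ψ n converges and the copying of W (ψ n) is blocked
-- forever by a correct computation. Were this so for every k ∉ K, then K ≤T A. Hence
-- f k is as required for some k ∉ K.

module Submission where

open import Defs
open import Axiom.ExcludedMiddle using (ExcludedMiddle)
open import Data.Empty using (⊥; ⊥-elim)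
open import Data.Fin using (Fin; zero; suc; #_)
open import Data.Nat using (ℕ; zero; suc; pred; _+_; _*_; _∸_; _≤_; _<_; _⊔_; z≤n; s≤s)
open import Data.Nat.Properties
open import Data.Product using (∃; _×_; _,_; proj₁; proj₂)
open import Data.Sum using (_⊎_; inj₁; inj₂)
open import Data.Unit using (⊤; tt)
open import Data.Vec using (Vec; []; _∷_; [_]; lookup; map; tabulate; tail; head)
open import Data.Vec.Relation.Binary.Pointwise.Inductive using (Pointwise; []; _∷_)
open import Function.Base using (_∘_; id)
open import Function.Bundles using (_⇔_; mk⇔; Equivalence)
open import Function.Properties.Equivalence using () renaming (trans to ⇔-trans)
open import Level using (0ℓ)
open import Relation.Binary.Definitions using (tri<; tri≈; tri>)
open import Relation.Binary.PropositionalEquality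
  using (_≡_; _≢_; refl; sym; trans; cong; cong₂; subst; module ≡-Reasoning)
open import Relation.Nullary using (¬_; yes; no; contradiction)
open import Relation.Unary using (Pred; _≐_)

-- Determinism of evaluation, and oracle-free programs as oracle programs

private
  variable
    I : Set
    O : I → Pred ℕ 0ℓ
    j k m : ℕ

Evals : (I → Pred ℕ 0ℓ) → Vec (Code I k) m → Vec ℕ k → Vec ℕ m → Set
Evals O cs xs ys = Pointwise (λ c y → Eval O c xs y) cs ys

mutual
  Eval-functional : (c : Code I k) → ∀ {xs y z} → Eval O c xs y → Eval O c xs z → y ≡ z
  Eval-functional zer ev-zer ev-zer = refl
  Eval-functional succ ev-succ ev-succ = refl
  Eval-functional (proj i) ev-proj ev-proj = refl
  Eval-functional {O = O} (query i) (ev-query {x = x} p) (ev-query q) =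
    functional (χ (O i)) {x ∷ []} p q
  Eval-functional (comp g hs) (ev-comp ps p) (ev-comp qs q)
    with refl ← Evals-functional hs ps qs = Eval-functional g p q
  Eval-functional (prec g h) (ev-prec0 p) (ev-prec0 q) = Eval-functional g p q
  Eval-functional (prec g h) (ev-precs r p) (ev-precs s q)
    with refl ← Eval-functional (prec g h) r s = Eval-functional h p q
  Eval-functional (mu g) (ev-mu {n = n} p below-n) (ev-mu {n = l} q below-l) with <-cmp n l
  ... | tri< n<l _ _ = contradiction (Eval-functional g p (proj₂ (below-l n<l))) λ ()
  ... | tri≈ _ n≡l _ = n≡l
  ... | tri> _ _ l<n = contradiction (Eval-functional g q (proj₂ (below-n l<n))) λ ()

  Evals-functional : (cs : Vec (Code I k) m) → ∀ {xs ys zs} →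
                     Evals O cs xs ys → Evals O cs xs zs → ys ≡ zs
  Evals-functional []       []       []       = refl
  Evals-functional (c ∷ cs) (p ∷ ps) (q ∷ qs) =
    cong₂ _∷_ (Eval-functional c p q) (Evals-functional cs ps qs)

mutual
  -- There is no clause for `query`: its index would be an element of `⊥`.
  relativize : Code ⊥ k → Code I k
  relativize zer         = zer
  relativize succ        = succ
  relativize (proj i)    = proj i
  relativize (comp g hs) = comp (relativize g) (relativizes hs)
  relativize (prec g h)  = prec (relativize g) (relativize h)
  relativize (mu g)      = mu (relativize g)

  relativizes : Vec (Code ⊥ k) m → Vec (Code I k) m
  relativizes []       = []
  relativizes (c ∷ cs) = relativize c ∷ relativizes cs

mutual
  relativize-Eval : (c : Code ⊥ k) → ∀ {xs y} →
                    Eval ⊥-elim c xs y → Eval O (relativize c) xs y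
  relativize-Eval zer         ev-zer         = ev-zer
  relativize-Eval succ        ev-succ        = ev-succ
  relativize-Eval (proj i)    ev-proj        = ev-proj
  relativize-Eval (comp g hs) (ev-comp ps p) = ev-comp (relativize-Evals hs ps) (relativize-Eval g p)
  relativize-Eval (prec g h)  (ev-prec0 p)   = ev-prec0 (relativize-Eval g p)
  relativize-Eval (prec g h)  (ev-precs r p) =
    ev-precs (relativize-Eval (prec g h) r) (relativize-Eval h p)
  relativize-Eval (mu g)      (ev-mu p below) =
    ev-mu (relativize-Eval g p) λ i<n → let v , q = below i<n in v , relativize-Eval g q

  relativize-Evals : (cs : Vec (Code ⊥ k) m) → ∀ {xs ys} →
                     Evals ⊥-elim cs xs ys → Evals O (relativizes cs) xs ys
  relativize-Evals []       []       = []
  relativize-Evals (c ∷ cs) (p ∷ ps) = relativize-Eval c p ∷ relativize-Evals cs ps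

-- Total computable functions

-- A function bundled with a program for it. The combinators below build both at once, so a
-- definition written with them carries its own proof of computability.
record Fn {I : Set} (O : I → Pred ℕ 0ℓ) (k : ℕ) : Set where
  field
    fun     : Vec ℕ k → ℕ
    code    : Code I k
    correct : ∀ xs → Eval O code xs (fun xs)

record Args {I : Set} (O : I → Pred ℕ 0ℓ) (k m : ℕ) : Set where
  field
    values : Vec ℕ k → Vec ℕ m
    codes  : Vec (Code I k) m
    evals  : ∀ xs → Evals O codes xs (values xs)

open Fn
open Args

Total : ℕ → Set
Total = Fn {⊥} ⊥-elim

relativizeFn : Total k → Fn O k
relativizeFn f = record
  { fun = fun f ; code = relativize (code f) ; correct = λ xs → relativize-Eval (code f) (correct f xs) }

-- Keeps the program but replaces the function by an extensionally equal one that computes better,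
-- so that later identities such as `verifyF-value` hold by `refl`.
withFun : (f : Fn O k) (g : Vec ℕ k → ℕ) → (∀ xs → fun f xs ≡ g xs) → Fn O k
withFun {O = O} f g f≗g = record
  { fun = g ; code = code f ; correct = λ xs → subst (Eval O (code f) xs) (f≗g xs) (correct f xs) }

infixr 5 _◂_

ε : Args O k 0
ε = record { values = λ _ → [] ; codes = [] ; evals = λ _ → [] }

_◂_ : Fn O k → Args O k m → Args O k (suc m)
f ◂ as = record
  { values = λ xs → fun f xs ∷ values as xs
  ; codes  = code f ∷ codes as
  ; evals  = λ xs → correct f xs ∷ evals as xs
  }

call : Fn O m → Args O k m → Fn O k
call f as = record
  { fun     = fun f ∘ values as
  ; code    = comp (code f) (codes as)
  ; correct = λ xs → ev-comp (evals as xs) (correct f (values as xs))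
  }

-- The counterpart of `call` for a program that may diverge: the arguments are total, so convergence
-- is decided by `c` alone.
Eval-call : (c : Code I m) (as : Args O k m) → ∀ {xs y} →
            Eval O (comp c (codes as)) xs y ⇔ Eval O c (values as xs) y
Eval-call {O = O} c as {xs} {y} = mk⇔ to (ev-comp (evals as xs))
  where
  to : Eval O (comp c (codes as)) xs y → Eval O c (values as xs) y
  to (ev-comp ps p) with refl ← Evals-functional (codes as) ps (evals as xs) = p

projections : (ρ : Fin m → Fin k) {xs : Vec ℕ k} (ys : Vec ℕ m) →
              (∀ i → lookup xs (ρ i) ≡ lookup ys i) → Evals O (tabulate (proj ∘ ρ)) xs ys
projections         ρ      []       eq = []
projections {O = O} ρ {xs} (y ∷ ys) eq =
  subst (Eval O (proj (ρ zero)) xs) (eq zero) ev-proj ∷ projections (ρ ∘ suc) ys (eq ∘ suc)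

all : Args O k k
all = record { values = id ; codes = tabulate proj ; evals = λ xs → projections id xs λ _ → refl }

-- Weakening: it passes on the original arguments underneath the `j` that recursion or search has
-- put in front.
from : ∀ j → Args O (j + k) k
from zero    = all
from {O = O} {k = k} (suc j) = record
  { values = values previous ∘ tail
  ; codes  = map (λ c → comp c (tabulate (proj ∘ suc))) (codes previous)
  ; evals  = λ { (x ∷ xs) → shift (codes previous) (evals previous xs) }
  }
  where
  previous : Args O (j + k) k
  previous = from j
  shift : ∀ {n l x} {xs : Vec ℕ n} {ys : Vec ℕ l} cs → Evals O cs xs ys →
          Evals O (map (λ c → comp c (tabulate (proj ∘ suc))) cs) (x ∷ xs) ys
  shift []       []       = []
  shift (c ∷ cs) (p ∷ ps) = ev-comp (projections suc _ λ _ → refl) p ∷ shift cs ps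

var : Fin k → Fn O k
var i = record { fun = λ xs → lookup xs i ; code = proj i ; correct = λ _ → ev-proj }

sucF : Fn O k → Fn O k
sucF f = record
  { fun = suc ∘ fun f ; code = comp succ (code f ∷ []) ; correct = λ xs → ev-comp (correct f xs ∷ []) ev-succ }

lit : ℕ → Fn O k
lit {O = O} {k = k} n = withFun (numeral n) (λ _ → n) (λ _ → numeral-value n)
  where
  numeral : ℕ → Fn O k
  numeral zero    = record { fun = λ _ → 0 ; code = zer ; correct = λ _ → ev-zer }
  numeral (suc n) = sucF (numeral n)
  numeral-value : ∀ n {xs} → fun (numeral n) xs ≡ n
  numeral-value zero    = refl
  numeral-value (suc n) = cong suc (numeral-value n)

natrec : ℕ → (ℕ → ℕ → ℕ) → ℕ → ℕ
natrec z s zero    = z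
natrec z s (suc n) = s n (natrec z s n)

recF : Fn O k → Fn O (suc (suc k)) → Fn O k → Fn O k
recF {O = O} z s n = record
  { fun     = λ xs → natrec (fun z xs) (λ i r → fun s (i ∷ r ∷ xs)) (fun n xs)
  ; code    = comp (prec (code z) (code s)) (code n ∷ codes {O = O} all)
  ; correct = λ xs → ev-comp (correct n xs ∷ evals all xs) (loop xs (fun n xs))
  }
  where
  loop : ∀ xs n → Eval O (prec (code z) (code s)) (n ∷ xs)
                       (natrec (fun z xs) (λ i r → fun s (i ∷ r ∷ xs)) n)
  loop xs zero    = ev-prec0 (correct z xs)
  loop xs (suc n) = ev-precs (loop xs n) (correct s _)

if0 : ℕ → ℕ → ℕ → ℕ
if0 zero    t e = t
if0 (suc _) t e = e

if0F : Fn O k → Fn O k → Fn O k → Fn O k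
if0F {O = O} c t e = withFun (recF t (call e (from 2)) c)
  (λ xs → if0 (fun c xs) (fun t xs) (fun e xs)) (λ xs → eq (fun c xs))
  where
  eq : ∀ {t e} n → natrec t (λ _ _ → e) n ≡ if0 n t e
  eq zero    = refl
  eq (suc n) = refl

predF : Fn O k → Fn O k
predF {O = O} {k = k} f = withFun (recF (lit 0) (var zero) f) (pred ∘ fun f) (λ xs → eq (fun f xs))
  where
  eq : ∀ n → natrec 0 (λ i _ → i) n ≡ pred n
  eq zero    = refl
  eq (suc n) = refl

infixl 6 _+F_ _∸F_
infixl 7 _*F_

_+F_ _∸F_ _*F_ : Fn O k → Fn O k → Fn O k
f +F g = withFun (recF g (sucF (var (# 1))) f) (λ xs → fun f xs + fun g xs) (λ xs → eq (fun f xs))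
  where
  eq : ∀ {y} x → natrec y (λ _ r → suc r) x ≡ x + y
  eq zero    = refl
  eq (suc x) = cong suc (eq x)
f ∸F g = withFun (recF f (predF (var (# 1))) g) (λ xs → fun f xs ∸ fun g xs) (λ xs → eq (fun g xs))
  where
  eq : ∀ {x} y → natrec x (λ _ r → pred r) y ≡ x ∸ y
  eq     zero    = refl
  eq {x} (suc y) = trans (cong pred (eq y)) (pred[m∸n]≡m∸[1+n] x y)
f *F g = withFun (recF (lit 0) (call g (from 2) +F var (# 1)) f) (λ xs → fun f xs * fun g xs)
                 (λ xs → eq (fun f xs))
  where
  eq : ∀ {y} x → natrec 0 (λ _ r → y + r) x ≡ x * y
  eq     zero    = refl
  eq {y} (suc x) = cong (y +_) (eq x)

-- The least n ≤ b with p n ≢ 0, and b if there is none.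
search : (ℕ → ℕ) → ℕ → ℕ
search p = natrec 0 λ _ r → if0 (p r) (suc r) r

searchF : Fn O (suc k) → Fn O k → Fn O k
searchF p b = recF (lit 0) (if0F p′ (sucF (var (# 1))) (var (# 1))) b
  where p′ = call p (var (# 1) ◂ from 2)

module _ (p : ℕ → ℕ) where

  search-≤ : ∀ b → search p b ≤ b
  search-≤ zero = z≤n
  search-≤ (suc b) with p (search p b)
  ... | zero  = s≤s (search-≤ b)
  ... | suc _ = m≤n⇒m≤1+n (search-≤ b)

  search-below : ∀ b {i} → i < search p b → p i ≡ 0
  search-below (suc b) i<r with p (search p b) in eq
  search-below (suc b) i<r | suc _ = search-below b i<r
  search-below (suc b) (s≤s i≤r) | zero with m≤n⇒m<n∨m≡n i≤r
  ... | inj₁ i<r  = search-below b i<r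
  ... | inj₂ refl = eq

  search-found : ∀ b → search p b < b → p (search p b) ≢ 0
  search-found (suc b) r<b with p (search p b) in eq
  search-found (suc b) r<b | suc _ = λ p≡0 → contradiction (trans (sym eq) p≡0) λ ()
  search-found (suc b) (s≤s r<b) | zero = contradiction eq (search-found b r<b)

  search-least : ∀ {b i} → i ≤ b → p i ≢ 0 → (∀ {l} → l < i → p l ≡ 0) → search p b ≡ i
  search-least {b} {i} i≤b pi below with <-cmp (search p b) i
  ... | tri< r<i _ _ = contradiction (below r<i) (search-found b (<-≤-trans r<i i≤b))
  ... | tri≈ _ r≡i _ = r≡i
  ... | tri> _ _ i<r = contradiction (search-below b i<r) pi

  -- The result `b` is ambiguous: it may be the first hit or mean that there is none. The value of
  -- `p` at the result tells these cases apart, with `b` itself included.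
  search-none : ∀ b → p (search p b) ≡ 0 → ∀ {i} → i ≤ b → p i ≡ 0
  search-none b p≡0 {i} i≤b with <-≤-connex i (search p b)
  ... | inj₁ i<r = search-below b i<r
  ... | inj₂ r≤i with m≤n⇒m<n∨m≡n (≤-trans r≤i i≤b)
  ...   | inj₁ r<b = contradiction p≡0 (search-found b r<b)
  ...   | inj₂ r≡b = trans (cong p (≤-antisym (≤-trans i≤b (≤-reflexive (sym r≡b))) r≤i)) p≡0

  search-hit : ∀ {b} → p b ≢ 0 → p (search p b) ≢ 0
  search-hit {b} pb p≡0 = pb (search-none b p≡0 ≤-refl)

≢0⇒suc : ∀ {n} → n ≢ 0 → ∃ λ l → n ≡ suc l
≢0⇒suc {zero}  n≢0 = contradiction refl n≢0
≢0⇒suc {suc l} _   = l , refl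

suc⇒≢0 : ∀ {n l} → n ≡ suc l → n ≢ 0
suc⇒≢0 refl ()

-- Pairing: ⟪ x , y ⟫ lies in the interval [s², (s+1)²) for s = x + y.

⟪_,_⟫ : ℕ → ℕ → ℕ
⟪ x , y ⟫ = (x + y) * (x + y) + x

-- `sqrt` is the integer square root, found as the least `s` with `z < (s + 1)²`; on a code it
-- returns the sum of the two components.
sqrt π₁ π₂ : ℕ → ℕ
sqrt z = search (λ s → suc s * suc s ∸ z) z
π₁ z = z ∸ sqrt z * sqrt z
π₂ z = sqrt z ∸ π₁ z

sqrt-pair : ∀ x y → sqrt ⟪ x , y ⟫ ≡ x + y
sqrt-pair x y = search-least _ s≤z (m>n⇒m∸n≢0 z<) below
  where
  s = x + y
  z = ⟪ x , y ⟫
  s≤s*s : ∀ s → s ≤ s * s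
  s≤s*s zero    = z≤n
  s≤s*s (suc s) = m≤m*n (suc s) (suc s)
  s≤z : s ≤ z
  s≤z = ≤-trans (s≤s*s s) (m≤m+n (s * s) x)
  z< : z < suc s * suc s
  z< = begin-strict
    s * s + x     ≤⟨ +-monoʳ-≤ (s * s) (m≤m+n x y) ⟩
    s * s + s     ≡⟨ +-comm (s * s) s ⟩
    s + s * s     ≡⟨ *-suc s s ⟨
    s * suc s     <⟨ m<n+m (s * suc s) {suc s} (s≤s z≤n) ⟩
    suc s * suc s ∎
    where open ≤-Reasoning
  below : ∀ {l} → l < s → suc l * suc l ∸ z ≡ 0
  below l<s = m≤n⇒m∸n≡0 (≤-trans (*-mono-≤ l<s l<s) (m≤m+n (s * s) x))

π₁-pair : ∀ x y → π₁ ⟪ x , y ⟫ ≡ x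
π₁-pair x y rewrite sqrt-pair x y = m+n∸m≡n ((x + y) * (x + y)) x

π₂-pair : ∀ x y → π₂ ⟪ x , y ⟫ ≡ y
π₂-pair x y rewrite π₁-pair x y | sqrt-pair x y = m+n∸m≡n x y

unpair : ∀ x y z → let u = ⟪ x , ⟪ y , z ⟫ ⟫ in
         _≡_ {A = Vec ℕ 3} (π₁ u ∷ π₁ (π₂ u) ∷ π₂ (π₂ u) ∷ []) (x ∷ y ∷ z ∷ [])
unpair x y z = cong₂ _∷_ (π₁-pair x ⟪ y , z ⟫)
  (cong₂ (λ v w → v ∷ w ∷ [])
         (trans (cong π₁ (π₂-pair x ⟪ y , z ⟫)) (π₁-pair y z))
         (trans (cong π₂ (π₂-pair x ⟪ y , z ⟫)) (π₂-pair y z)))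

pairF : Fn O k → Fn O k → Fn O k
pairF f g = (f +F g) *F (f +F g) +F f

sqrtF π₁F π₂F : Fn O k → Fn O k
sqrtF f = searchF (sucF (var zero) *F sucF (var zero) ∸F call f (from 1)) f
π₁F f = f ∸F sqrtF f *F sqrtF f
π₂F f = sqrtF f ∸F π₁F f

-- Properties of all sufficiently large stages

Eventually : (ℕ → Set) → Set
Eventually P = ∃ λ b₀ → ∀ {b} → b₀ ≤ b → P b

always : {P : ℕ → Set} → (∀ {b} → P b) → Eventually P
always p = 0 , λ _ → p

both : {P Q R : ℕ → Set} → (∀ {b} → P b → Q b → R b) → Eventually P → Eventually Q → Eventually R
both f (b₁ , p) (b₂ , q) = b₁ ⊔ b₂ , λ ≤b → f (p (m⊔n≤o⇒m≤o b₁ b₂ ≤b)) (q (m⊔n≤o⇒n≤o b₁ b₂ ≤b))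

eventually-below : ∀ n {P : ℕ → ℕ → Set} → (∀ {i} → i < n → Eventually (P i)) →
                   Eventually (λ b → ∀ {i} → i < n → P i b)
eventually-below zero    p = always λ ()
eventually-below (suc n) {P} p = both extend (eventually-below n (p ∘ m≤n⇒m≤1+n)) (p ≤-refl)
  where
  extend : ∀ {b} → (∀ {i} → i < n → P i b) → P n b → ∀ {i} → i < suc n → P i b
  extend below here (s≤s i≤n) with m≤n⇒m<n∨m≡n i≤n
  ... | inj₁ i<n  = below i<n
  ... | inj₂ refl = here

-- Evaluation in stages. In the result 0 means "no value yet" and suc y means "value y".

-- For a staged `p`, 1 means "value zero" and numbers from 2 on mean a positive value. The search
-- stops at the first `i` with `p i ≤ 1`; only `p i ≡ 1` yields a result, since an undefined `p i`
-- must block minimization.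
minimize : (ℕ → ℕ) → ℕ → ℕ
minimize p b = if0 (p r) 0 (if0 (pred (p r)) (suc r) 0)
  where r = search (λ i → if0 (pred (p i)) 1 0) b

minimizeF : Fn O (suc k) → Fn O k → Fn O k
minimizeF p b = if0F p[r] (lit 0) (if0F (predF p[r]) (sucF r) (lit 0))
  where
  r    = searchF (if0F (predF p) (lit 1) (lit 0)) b
  p[r] = call p (r ◂ all)

minimize-sound : ∀ p b {y} → minimize p b ≡ suc y →
                 y ≤ b × p y ≡ 1 × (∀ {i} → i < y → ∃ λ v → p i ≡ suc (suc v))
minimize-sound p b eq with search (λ i → if0 (pred (p i)) 1 0) b in eqr
... | r with p r in eqp
minimize-sound p b refl | r | suc zero =
  subst (_≤ b) eqr (search-≤ _ b) , eqp , λ i<r → ≥2 _ (search-below _ b (subst (_ <_) (sym eqr) i<r))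
  where
  ≥2 : ∀ n → if0 (pred n) 1 0 ≡ 0 → ∃ λ v → n ≡ suc (suc v)
  ≥2 (suc (suc v)) _ = v , refl

minimize-complete : ∀ p {b y} → y ≤ b → p y ≡ 1 → (∀ {i} → i < y → ∃ λ v → p i ≡ suc (suc v)) →
                    minimize p b ≡ suc y
minimize-complete p {b} {y} y≤b py below =
  trans (cong result (search-least _ y≤b (λ p≡0 → 1+n≢0 (trans (sym hit) p≡0)) miss)) found
  where
  result : ℕ → ℕ
  result r = if0 (p r) 0 (if0 (pred (p r)) (suc r) 0)
  found : result y ≡ suc y
  found rewrite py = refl
  hit : if0 (pred (p y)) 1 0 ≡ 1
  hit rewrite py = refl
  miss : ∀ {i} → i < y → if0 (pred (p i)) 1 0 ≡ 0
  miss i<y rewrite proj₂ (below i<y) = refl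

-- The expression with `if0` is sequencing of staged values: `f` runs on the value of `a`, if there
-- is one.
andThen-sound : ∀ a (f : ℕ → ℕ) {y} → if0 a 0 (f (pred a)) ≡ suc y → ∃ λ r → a ≡ suc r × f r ≡ suc y
andThen-sound (suc r) f eq = r , refl , eq

andThen-complete : ∀ {a r} (f : ℕ → ℕ) → a ≡ suc r → if0 a 0 (f (pred a)) ≡ f r
andThen-complete f refl = refl

allPositive : Vec ℕ m → ℕ
allPositive []       = 1
allPositive (x ∷ xs) = if0 x 0 (allPositive xs)

allPositiveF : Fn O m
allPositiveF {O = O} = withFun loop allPositive loop≗
  where
  loop : ∀ {l} → Fn O l
  loop {zero}  = lit 1
  loop {suc l} = if0F (var zero) (lit 0) (call loop (from 1))
  loop≗ : ∀ {l} (xs : Vec ℕ l) → fun loop xs ≡ allPositive xs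
  loop≗ []       = refl
  loop≗ (x ∷ xs) = cong (if0 x 0) (loop≗ xs)

predArgs : Args O k m → Args O k m
predArgs {O = O} as = record
  { values = map pred ∘ values as
  ; codes  = map (λ c → comp (code pred₁) (c ∷ [])) (codes as)
  ; evals  = λ xs → preds (evals as xs)
  }
  where
  pred₁ : Fn O 1
  pred₁ = predF (var zero)
  preds : ∀ {n l} {cs : Vec (Code _ n) l} {xs ys} → Evals O cs xs ys →
          Evals O (map (λ c → comp (code pred₁) (c ∷ [])) cs) xs (map pred ys)
  preds []       = []
  preds (p ∷ ps) = ev-comp (p ∷ []) (correct pred₁ _) ∷ preds ps

strict : (Vec ℕ m → ℕ) → Vec ℕ m → ℕ
strict f xs = if0 (allPositive xs) 0 (f (map pred xs))

strict-sound : ∀ f (xs : Vec ℕ m) {y} → strict f xs ≡ suc y → ∃ λ ys → xs ≡ map suc ys × f ys ≡ suc y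
strict-sound f []             eq = [] , refl , eq
strict-sound f (suc x ∷ xs) eq with strict-sound (λ ys → f (x ∷ ys)) xs eq
... | ys , refl , eq′ = x ∷ ys , refl , eq′

strict-complete : ∀ f (ys : Vec ℕ m) → strict f (map suc ys) ≡ f ys
strict-complete f []       = refl
strict-complete f (y ∷ ys) = strict-complete (λ zs → f (y ∷ zs)) ys

module Staging {I : Set} (q : I → Total 3) where

  -- The arguments of stage c are a bound b on the unbounded searches, a stage s of the
  -- approximation q i (b ∷ s ∷ x ∷ []) to oracle i at x, and the input of c.
  mutual
    stage : Code I k → Total (suc (suc k))
    stage zer         = lit 1
    stage succ        = sucF (sucF (var (# 2)))
    stage (proj i)    = sucF (var (suc (suc i)))
    stage (query i)   = q i
    stage (comp g hs) = if0F (call allPositiveF (stages hs)) (lit 0)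
                             (call (stage g) (var (# 0) ◂ var (# 1) ◂ predArgs (stages hs)))
    stage (prec g h)  = recF (call (stage g) (var (# 0) ◂ var (# 1) ◂ from 3))
      (if0F (var (# 1)) (lit 0)
            (call (stage h) (var (# 2) ◂ var (# 3) ◂ var (# 0) ◂ predF (var (# 1)) ◂ from 5)))
      (var (# 2))
    stage (mu g)      =
      minimizeF (call (stage g) (var (# 1) ◂ var (# 2) ◂ var (# 0) ◂ from 3)) (var (# 0))

    stages : Vec (Code I k) m → Args {⊥} ⊥-elim (suc (suc k)) m
    stages []       = ε
    stages (c ∷ cs) = stage c ◂ stages cs

  value : Code I k → ℕ → ℕ → Vec ℕ k → ℕ
  value c b s xs = fun (stage c) (b ∷ s ∷ xs)

  valuesAt : Vec (Code I k) m → ℕ → ℕ → Vec ℕ k → Vec ℕ m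
  valuesAt cs b s xs = values (stages cs) (b ∷ s ∷ xs)

  module _ {b s b′ s′ : ℕ} (b≤b′ : b ≤ b′)
           (q-mono : ∀ i x {v} → fun (q i) (b ∷ s ∷ x ∷ []) ≡ suc v → fun (q i) (b′ ∷ s′ ∷ x ∷ []) ≡ suc v)
           where
    mutual
      -- A computation repeats itself as long as the oracle answers it received are repeated.
      -- Nothing is assumed about queries that were unanswered at `b` and `s`.
      value-mono : ∀ (c : Code I k) {xs y} → value c b s xs ≡ suc y → value c b′ s′ xs ≡ suc y
      value-mono zer eq = eq
      value-mono succ {_ ∷ []} eq = eq
      value-mono (proj i) eq = eq
      value-mono (query i) {x ∷ []} eq = q-mono i x eq
      value-mono (comp g hs) {xs} eq with strict-sound (value g b s) (valuesAt hs b s xs) eq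
      ... | ys , eqs , eq′ =
        trans (cong (strict (value g b′ s′)) (valuesAt-mono hs eqs))
              (trans (strict-complete (value g b′ s′) ys) (value-mono g eq′))
      value-mono (prec g h) {n ∷ xs} = loop n
        where
        loop : ∀ n {y} → value (prec g h) b s (n ∷ xs) ≡ suc y → value (prec g h) b′ s′ (n ∷ xs) ≡ suc y
        loop zero    eq = value-mono g eq
        loop (suc n) eq
          with andThen-sound (value (prec g h) b s (n ∷ xs)) (λ r → value h b s (n ∷ r ∷ xs)) eq
        ... | r , eqr , eqh =
          trans (andThen-complete (λ r → value h b′ s′ (n ∷ r ∷ xs)) (loop n eqr)) (value-mono h eqh)
      value-mono (mu g) {xs} eq with minimize-sound (λ i → value g b s (i ∷ xs)) b eq
      ... | y≤b , gy , below =
        minimize-complete (λ i → value g b′ s′ (i ∷ xs)) (≤-trans y≤b b≤b′) (value-mono g gy)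
          (λ i<y → let v , gi = below i<y in v , value-mono g gi)

      valuesAt-mono : ∀ (cs : Vec (Code I k) m) {xs ys} →
                      valuesAt cs b s xs ≡ map suc ys → valuesAt cs b′ s′ xs ≡ map suc ys
      valuesAt-mono []       {ys = []}     eq = refl
      valuesAt-mono (c ∷ cs) {ys = y ∷ ys} eq =
        cong₂ _∷_ (value-mono c (cong head eq)) (valuesAt-mono cs (cong tail eq))

  module _ {O : I → Pred ℕ 0ℓ} where

    module _ {b s : ℕ} (q-sound : ∀ i x {v} → fun (q i) (b ∷ s ∷ x ∷ []) ≡ suc v → CharGraph (O i) x v)
             where
      mutual
        value-sound : ∀ (c : Code I k) {xs y} → value c b s xs ≡ suc y → Eval O c xs y
        value-sound zer refl = ev-zer
        value-sound succ {_ ∷ []} refl = ev-succ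
        value-sound (proj i) refl = ev-proj
        value-sound (query i) {x ∷ []} eq = ev-query (q-sound i x eq)
        value-sound (comp g hs) {xs} eq with strict-sound (value g b s) (valuesAt hs b s xs) eq
        ... | ys , eqs , eq′ = ev-comp (valuesAt-sound hs eqs) (value-sound g eq′)
        value-sound (prec g h) {n ∷ xs} = loop n
          where
          loop : ∀ n {y} → value (prec g h) b s (n ∷ xs) ≡ suc y → Eval O (prec g h) (n ∷ xs) y
          loop zero    eq = ev-prec0 (value-sound g eq)
          loop (suc n) eq
            with andThen-sound (value (prec g h) b s (n ∷ xs)) (λ r → value h b s (n ∷ r ∷ xs)) eq
          ... | r , eqr , eqh = ev-precs (loop n eqr) (value-sound h eqh)
        value-sound (mu g) {xs} eq with minimize-sound (λ i → value g b s (i ∷ xs)) b eq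
        ... | y≤b , gy , below =
          ev-mu (value-sound g gy) (λ i<y → let v , gi = below i<y in v , value-sound g gi)

        valuesAt-sound : ∀ (cs : Vec (Code I k) m) {xs ys} →
                         valuesAt cs b s xs ≡ map suc ys → Evals O cs xs ys
        valuesAt-sound []       {ys = []}     eq = []
        valuesAt-sound (c ∷ cs) {ys = y ∷ ys} eq =
          value-sound c (cong head eq) ∷ valuesAt-sound cs (cong tail eq)

    module _ (Good : ℕ → ℕ → Set)
             (q-complete : ∀ {b s} → Good b s →
               ∀ i {x v} → x < b → CharGraph (O i) x v → fun (q i) (b ∷ s ∷ x ∷ []) ≡ suc v)
             where
      mutual
        -- The threshold for `b` is found before `s` is given: a halting computation makes finitely
        -- many queries and searches, and a `b` bounding them all works at every good stage.
        value-complete : ∀ (c : Code I k) {xs y} → Eval O c xs y →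
                         Eventually λ b → ∀ s → Good b s → value c b s xs ≡ suc y
        value-complete zer ev-zer = always λ _ _ → refl
        value-complete succ ev-succ = always λ _ _ → refl
        value-complete (proj i) ev-proj = always λ _ _ → refl
        value-complete (query i) (ev-query {x = x} p) = suc x , λ x<b _ good → q-complete good i x<b p
        value-complete (comp g hs) (ev-comp {ys = ys} ps p) =
          both (λ {b} eqs eq s good → trans (cong (strict (value g b s)) (eqs s good))
                                              (trans (strict-complete (value g b s) ys) (eq s good)))
               (valuesAt-complete hs ps) (value-complete g p)
        value-complete (prec g h) (ev-prec0 p) = value-complete g p
        value-complete (prec g h) (ev-precs {xs = xs} {n = n} r p) =
          both (λ {b} eqr eqh s good →
                  trans (andThen-complete (λ r → value h b s (n ∷ r ∷ xs)) (eqr s good)) (eqh s good))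
               (value-complete (prec g h) r) (value-complete h p)
        value-complete (mu g) (ev-mu {xs = xs} {n = n} p below) =
          both (λ {b} (n≤b , eqn) eqs s good →
                  minimize-complete (λ i → value g b s (i ∷ xs)) n≤b (eqn s good) (λ i<n → eqs i<n s good))
               (both _,_ (n , id) (value-complete g p))
               (eventually-below n (λ i<n → let v , e = below i<n ; b₀ , eq = value-complete g e in
                                            b₀ , λ b₀≤b s good → v , eq b₀≤b s good))

        valuesAt-complete : ∀ (cs : Vec (Code I k) m) {xs ys} → Evals O cs xs ys →
                            Eventually λ b → ∀ s → Good b s → valuesAt cs b s xs ≡ map suc ys
        valuesAt-complete []       []       = always λ _ _ → refl
        valuesAt-complete (c ∷ cs) (p ∷ ps) =
          both (λ eq eqs s good → cong₂ _∷_ (eq s good) (eqs s good)) (value-complete c p) (valuesAt-complete cs ps)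

-- Oracle-free programs in stages

stepF : Code ⊥ k → Total (suc k)
-- With no oracle to approximate, the stage is fixed at 0 and the bound serves as running time.
stepF c = call (Staging.stage ⊥-elim c) (var zero ◂ lit 0 ◂ from 1)

step : Code ⊥ k → ℕ → Vec ℕ k → ℕ
step c t xs = fun (stepF c) (t ∷ xs)

step-mono : ∀ (c : Code ⊥ k) {s t xs y} → s ≤ t → step c s xs ≡ suc y → step c t xs ≡ suc y
step-mono c s≤t = Staging.value-mono ⊥-elim s≤t (λ i → ⊥-elim i) c

step-sound : ∀ (c : Code ⊥ k) t {xs y} → step c t xs ≡ suc y → Eval ⊥-elim c xs y
step-sound c t = Staging.value-sound ⊥-elim (λ i → ⊥-elim i) c

step-complete : ∀ (c : Code ⊥ k) {xs y} → Eval ⊥-elim c xs y → Eventually λ t → step c t xs ≡ suc y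
step-complete c p with Staging.value-complete ⊥-elim (λ _ _ → ⊤) (λ _ i → ⊥-elim i) c p
... | t₀ , eq = t₀ , λ t₀≤t → eq t₀≤t 0 tt

Total⇒Computable : (f : Total 1) → Computable (λ n → fun f [ n ])
Total⇒Computable f = code f , λ { (x ∷ []) y → mk⇔ (λ { refl → correct f [ x ] })
                                                   (Eval-functional (code f) (correct f [ x ])) }

-- The s-m-n property and the recursion theorem

module Recursion (φ : Numbering) (acceptable : Acceptable φ) where

  open Acceptable acceptable

  U : Code ⊥ 2
  U = proj₁ enumeration

  U-correct : ∀ e x y → φ e ⟨ x ⟩≃ y ⇔ Eval ⊥-elim U (e ∷ x ∷ []) y
  U-correct e x y = proj₂ enumeration (e ∷ x ∷ []) y

  parametrize : (c : Code ⊥ 2) → ∃ λ (s : Total 1) →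
                ∀ e x y → φ (fun s [ e ]) ⟨ x ⟩≃ y ⇔ Eval ⊥-elim c (e ∷ x ∷ []) y
  parametrize c
    with s-m-n (record { graph = Eval ⊥-elim c ; functional = Eval-functional c })
               (c , λ _ _ → mk⇔ id id)
  ... | s , (s-code , s-code⇔) , s⇔ = record
    { fun     = λ { (e ∷ []) → s e }
    ; code    = s-code
    ; correct = λ { (e ∷ []) → Equivalence.to (s-code⇔ (e ∷ []) (s e)) refl }
    } , s⇔

  -- The s-m-n property for a program that ignores its parameter, evaluated at the parameter 0.
  index : (c : Code ⊥ 1) → ∃ λ v → ∀ x y → φ v ⟨ x ⟩≃ y ⇔ Eval ⊥-elim c [ x ] y
  index c = let s , s⇔ = parametrize (comp c (codes second)) in
            fun s [ 0 ] , λ x y → ⇔-trans (s⇔ 0 x y) (Eval-call c second)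
    where
    second : Args ⊥-elim 2 1
    second = var (# 1) ◂ ε

  simulate : Code ⊥ 2 → Code ⊥ 2
  simulate c = comp U (c ∷ proj (# 1) ∷ [])

  simulate-correct : ∀ c {u x w y} → Eval ⊥-elim c (u ∷ x ∷ []) w →
                     Eval ⊥-elim (simulate c) (u ∷ x ∷ []) y ⇔ φ w ⟨ x ⟩≃ y
  simulate-correct c {u} {x} {w} {y} p = mk⇔ to λ r → ev-comp (p ∷ ev-proj ∷ []) (Equivalence.to (U-correct w x y) r)
    where
    to : Eval ⊥-elim (simulate c) (u ∷ x ∷ []) y → φ w ⟨ x ⟩≃ y
    to (ev-comp (q ∷ ev-proj ∷ []) r) with refl ← Eval-functional c p q = Equivalence.from (U-correct w x y) r

  opaque
    -- Kleene's recursion theorem with a parameter: `c` receives its own index paired with `p`. For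
    -- `u = ⟪ v , p ⟫`, the index `d u` runs the index `φ v u`. Here `v` is an index of `diagonal`,
    -- which sends `u` to the index `g ⟪ d u , p ⟫` of `c` with first argument `⟪ d u , p ⟫`. So
    -- `p ↦ d ⟪ v , p ⟫` is as required.
    recursion : (c : Code ⊥ 2) → ∃ λ (f : Total 1) →
                ∀ p x y → φ (fun f [ p ]) ⟨ x ⟩≃ y ⇔ Eval ⊥-elim c (⟪ fun f [ p ] , p ⟫ ∷ x ∷ []) y
    recursion c = call d (pairF (lit v) (var zero) ◂ ε) , fixed
      where
      g : Total 1
      g = proj₁ (parametrize c)
      applyArgs : Args {⊥} ⊥-elim 2 2
      applyArgs = π₁F (var zero) ◂ var zero ◂ ε
      -- u = ⟪ v , p ⟫ ↦ φ v u
      apply : Code ⊥ 2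
      apply = comp U (codes applyArgs)
      d : Total 1
      d = proj₁ (parametrize (simulate apply))
      diagonal : Total 1
      diagonal = call g (pairF d (π₂F (var zero)) ◂ ε)
      v : ℕ
      v = proj₁ (index (code diagonal))
      fixed : ∀ p x y → φ (fun d [ ⟪ v , p ⟫ ]) ⟨ x ⟩≃ y ⇔
                        Eval ⊥-elim c (⟪ fun d [ ⟪ v , p ⟫ ] , p ⟫ ∷ x ∷ []) y
      fixed p x y =
        subst (λ p′ → φ (fun d [ u ]) ⟨ x ⟩≃ y ⇔ Eval ⊥-elim c (⟪ fun d [ u ] , p′ ⟫ ∷ x ∷ []) y)
              (π₂-pair v p)
              (⇔-trans (proj₂ (parametrize (simulate apply)) u x y)
              (⇔-trans (simulate-correct apply applied)
                       (proj₂ (parametrize c) ⟪ fun d [ u ] , π₂ u ⟫ x y)))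
        where
        u : ℕ
        u = ⟪ v , p ⟫
        applied : Eval ⊥-elim apply (u ∷ x ∷ []) (fun diagonal [ u ])
        applied = Equivalence.from (Eval-call U applyArgs)
          (Equivalence.to (U-correct (π₁ u) u _)
            (subst (λ v′ → φ v′ ⟨ u ⟩≃ fun diagonal [ u ]) (sym (π₁-pair v p))
              (Equivalence.from (proj₂ (index (code diagonal)) u _) (correct diagonal [ u ]))))

-- The choice of what to copy, on staged values

if0-positive : ∀ {a b c} → if0 a 0 b ≡ suc c → a ≢ 0 × b ≡ suc c
if0-positive {suc a} eq = 1+n≢0 , eq

if0-zero : ∀ {a b} → a ≢ 0 → if0 a 0 b ≡ 0 → b ≡ 0
if0-zero {zero}  a≢0 _  = contradiction refl a≢0
if0-zero {suc a} _   eq = eq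

-- `p` is the staged value of `ψ n`, `d` the computation of `δ` that may block it, and `c` the
-- alternative.
select : ℕ → ℕ → ℕ → ℕ
select p d c = if0 p c (if0 d p c)

select-positive : ∀ p d c {y} → select p d c ≡ suc y → (p ≡ suc y × d ≡ 0) ⊎ c ≡ suc y
select-positive zero    d       c eq = inj₂ eq
select-positive (suc p) zero    c eq = inj₁ (eq , refl)
select-positive (suc p) (suc d) c eq = inj₂ eq

select-zero : ∀ p d c → select p d c ≡ 0 → c ≡ 0 × (p ≢ 0 → d ≢ 0)
select-zero zero    d       c eq = eq , λ p≢0 → contradiction refl p≢0
select-zero (suc p) zero    c ()
select-zero (suc p) (suc d) c eq = eq , λ _ → 1+n≢0

module Construction
  (em : ExcludedMiddle 0ℓ) (φ : Numbering) (acceptable : Acceptable φ)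
  (A : Pred ℕ 0ℓ) (a : ℕ) (A≐Wa : A ≐ W φ a)
  (δ : Partial 1) (δ-code : Code ⊤ 1)
  (δ-correct : ∀ xs y → graph δ xs y ⇔ Eval (λ _ → A) δ-code xs y)
  (δ-fpf : FixedPointFree φ δ)
  (ψ : Partial 1) (ψ-code : Code ⊥ 1)
  (ψ-correct : ∀ xs y → graph ψ xs y ⇔ Eval ⊥-elim ψ-code xs y)
  where

  open Recursion φ acceptable

  -- Enumerations of `K` and `A` in stages

  K : Pred ℕ 0ℓ
  K = ∅′ φ

  haltF : Total 2
  haltF = call (stepF U) (var (# 0) ◂ var (# 1) ◂ var (# 1) ◂ ε)

  opaque
    halt : ℕ → ℕ → ℕ
    halt t k = fun haltF (t ∷ k ∷ [])

    halt-sound : ∀ t k → halt t k ≢ 0 → K k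
    halt-sound t k h = let y , eq = ≢0⇒suc h in
                       y , Equivalence.from (U-correct k k y) (step-sound U t eq)

    halt-complete : ∀ {k} → K k → Eventually λ t → halt t k ≢ 0
    halt-complete {k} (y , p) with step-complete U (Equivalence.to (U-correct k k y) p)
    ... | t₀ , eq = t₀ , λ t₀≤t → suc⇒≢0 (eq t₀≤t)

  approxF : Total 2
  approxF = if0F (call (stepF U) (var (# 0) ◂ lit a ◂ var (# 1) ◂ ε)) (lit 0) (lit 1)

  opaque
    approx : ℕ → ℕ → ℕ
    approx s x = fun approxF (s ∷ x ∷ [])

    approx-≤1 : ∀ s x → approx s x ≤ 1
    approx-≤1 s x with step U s (a ∷ x ∷ [])
    ... | zero  = z≤n
    ... | suc _ = s≤s z≤n

    approx-outside : ∀ s {x} → ¬ A x → approx s x ≡ 0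
    approx-outside s {x} x∉A with step U s (a ∷ x ∷ []) in eq
    ... | zero  = refl
    ... | suc y = contradiction (proj₂ A≐Wa (y , Equivalence.from (U-correct a x y) (step-sound U s eq))) x∉A

    approx-inside : ∀ {x} → A x → Eventually λ s → approx s x ≡ 1
    approx-inside {x} x∈A with proj₁ A≐Wa x∈A
    ... | y , p with step-complete U (Equivalence.to (U-correct a x y) p)
    ... | s₀ , eq = s₀ , λ s₀≤s → cong (λ r → if0 r 0 1) (eq s₀≤s)

    approx-mono : ∀ {s t x} → s ≤ t → approx s x ≡ 1 → approx t x ≡ 1
    approx-mono {s} {t} {x} s≤t eq with step U s (a ∷ x ∷ []) in eqs
    ... | suc y = cong (λ r → if0 r 0 1) (step-mono U s≤t eqs)

  -- As `approx` errs only by omission, this amounts to agreement with `A` below `b`, and it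
  -- persists at later stages.
  Settled : ℕ → ℕ → Set
  Settled b s = ∀ {x} → x < b → A x → approx s x ≡ 1

  settled-mono : ∀ {b s t} → s ≤ t → Settled b s → Settled b t
  settled-mono s≤t settled x<b x∈A = approx-mono s≤t (settled x<b x∈A)

  settled-antitone : ∀ {b b′ s} → b′ ≤ b → Settled b s → Settled b′ s
  settled-antitone b′≤b settled x<b′ = settled (<-≤-trans x<b′ b′≤b)

  eventually-settled : ∀ b → Eventually (Settled b)
  eventually-settled b with eventually-below b {λ x s → A x → approx s x ≡ 1} inside?
    where
    inside? : ∀ {x} → x < b → Eventually λ s → A x → approx s x ≡ 1
    inside? {x} _ with em {A x}
    ... | yes x∈A = let s₀ , eq = approx-inside x∈A in s₀ , λ s₀≤s _ → eq s₀≤s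
    ... | no  x∉A = always λ x∈A → contradiction x∈A x∉A
  ... | s₀ , settled = s₀ , λ s₀≤s x<b → settled s₀≤s x<b

  char : ∀ B x → ∃ (CharGraph B x)
  char B x with em {B x}
  ... | yes x∈B = 1 , inside x∈B
  ... | no  x∉B = 0 , outside x∉B

  settled-char : ∀ {b s x v} → Settled b s → x < b → CharGraph A x v → approx s x ≡ v
  settled-char settled x<b (inside x∈A) = settled x<b x∈A
  settled-char {s = s} settled x<b (outside x∉A) = approx-outside s x∉A

  -- Queries at x ≥ b are left unanswered, so that a value found with bound b only
  -- depends on the oracle below b.
  oracleF : ⊤ → Total 3
  oracleF _ = if0F (var (# 0) ∸F var (# 2)) (lit 0) (sucF (call approxF (var (# 1) ◂ var (# 2) ◂ ε)))

  oracle : ℕ → ℕ → ℕ → ℕ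
  oracle b s x = fun (oracleF tt) (b ∷ s ∷ x ∷ [])

  opaque
    unfolding approx

    oracle-below : ∀ {b s x} → x < b → oracle b s x ≡ suc (approx s x)
    oracle-below {b} {s} {x} x<b with b ∸ x in eq
    ... | zero  = contradiction eq (m>n⇒m∸n≢0 x<b)
    ... | suc _ = refl

  oracle-bound : ∀ {b s x v} → oracle b s x ≡ suc v → x < b
  oracle-bound {b} {s} {x} eq = m∸n≢0⇒n<m (proj₁ (if0-positive {b ∸ x} eq))

  oracle-complete : ∀ {b s} → Settled b s →
                    ∀ (i : ⊤) {x v} → x < b → CharGraph A x v → oracle b s x ≡ suc v
  oracle-complete settled _ x<b p = trans (oracle-below x<b) (cong suc (settled-char settled x<b p))

  oracle-sound : ∀ {b s} → Settled b s → ∀ (i : ⊤) x {v} → oracle b s x ≡ suc v → CharGraph A x v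
  oracle-sound settled i x eq with char A x
  ... | v′ , p with refl ← trans (sym (oracle-complete settled i (oracle-bound eq) p)) eq = p

  open Staging oracleF

  -- Approximations to `δ` and `ψ`

  opaque
    δAt : ℕ → ℕ → ℕ → ℕ
    δAt b s e = value δ-code b s [ e ]

    δAt-sound : ∀ {b s e d} → Settled b s → δAt b s e ≡ suc d → δ ⟨ e ⟩≃ d
    δAt-sound settled eq =
      Equivalence.from (δ-correct _ _) (value-sound (oracle-sound settled) δ-code eq)

    δAt-complete : ∀ {e d} → δ ⟨ e ⟩≃ d → Eventually λ b → ∀ s → Settled b s → δAt b s e ≡ suc d
    δAt-complete p = value-complete Settled oracle-complete δ-code (Equivalence.to (δ-correct _ _) p)

    -- A computation found with bound `b` only queries below `b`, where both stages agree with `A`.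
    -- Hence `b′` may exceed what is settled at `t`.
    δAt-mono : ∀ {b b′ s t e d} → b ≤ b′ → Settled b s → Settled b t →
               δAt b s e ≡ suc d → δAt b′ t e ≡ suc d
    δAt-mono {b} {b′} {s} {t} b≤b′ settled-s settled-t = value-mono b≤b′ oracle-mono δ-code
      where
      oracle-mono : ∀ (i : ⊤) x {v} → oracle b s x ≡ suc v → oracle b′ t x ≡ suc v
      oracle-mono i x eq =
        trans (oracle-below (<-≤-trans x<b b≤b′))
              (cong suc (settled-char settled-t x<b (oracle-sound settled-s i x eq)))
        where
        x<b : x < b
        x<b = oracle-bound eq

  opaque
    ψAt : ℕ → ℕ → ℕ
    ψAt t n = step ψ-code t [ n ]

    ψAt-sound : ∀ t n {m} → ψAt t n ≡ suc m → ψ ⟨ n ⟩≃ m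
    ψAt-sound t n eq = Equivalence.from (ψ-correct _ _) (step-sound ψ-code t eq)

    ψAt-complete : ∀ {n m} → ψ ⟨ n ⟩≃ m → Eventually λ t → ψAt t n ≡ suc m
    ψAt-complete p = step-complete ψ-code (Equivalence.to (ψ-correct _ _) p)

  -- Constant in `t` once `ψ n` has halted, and equal to `t` before. With the bound thus fixed, `A`
  -- settles below it, so a computation of `δ` that blocks forever must eventually be correct.
  ψTime : ℕ → ℕ → ℕ
  ψTime t n = search (λ i → ψAt i n) t

  -- At stage t the set W e, where e = f ⟪ k , n ⟫, may start to copy W (ψ n) if the
  -- computation of δ e bounded by the halting time of ψ n is undefined with the current
  -- approximation to A, and to copy W (δ e), as currently approximated, if k ∈ K at t.
  actionF : Total 4
  actionF = if0F p copyδ (if0F d p copyδ)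
    where
    r     = searchF (call (stepF ψ-code) (var (# 0) ◂ var (# 4) ◂ ε)) (var (# 0))
    p     = call (stepF ψ-code) (r ◂ var (# 3) ◂ ε)
    d     = call (stage δ-code) (r ◂ var (# 0) ◂ var (# 1) ◂ ε)
    copyδ = if0F (call haltF (var (# 0) ◂ var (# 2) ◂ ε)) (lit 0)
                 (call (stage δ-code) (var (# 0) ◂ var (# 0) ◂ var (# 1) ◂ ε))

  opaque
    unfolding halt δAt ψAt

    action : ℕ → ℕ → ℕ → ℕ → ℕ
    action e k n t = fun actionF (t ∷ e ∷ k ∷ n ∷ [])

    action-select : ∀ e k n t → action e k n t ≡
      select (ψAt (ψTime t n) n) (δAt (ψTime t n) t e) (if0 (halt t k) 0 (δAt t t e))
    action-select e k n t = refl

  opaque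
    unfolding action

    codedActionF : Total 2
    codedActionF = call actionF
      (var (# 0) ◂ π₁F (var (# 1)) ◂ π₁F (π₂F (var (# 1))) ◂ π₂F (π₂F (var (# 1))) ◂ ε)

    codedActionF-value : ∀ t e k n → fun codedActionF (t ∷ ⟪ e , ⟪ k , n ⟫ ⟫ ∷ []) ≡ action e k n t
    codedActionF-value t e k n = cong (fun actionF ∘ (t ∷_)) (unpair e k n)

  idleF : Total 3
  idleF = if0F (call codedActionF (var (# 0) ◂ var (# 1) ◂ ε)) (lit 1) (lit 0)

  targetF : Total 2
  targetF = predF codedActionF

  opaque
    -- Waits for the first stage with an action and returns the index to be copied; `pred` inside
    -- `targetF` decodes the staged value.
    firstTarget : Code ⊥ 2
    firstTarget = comp (code targetF) (mu (code idleF) ∷ proj (# 0) ∷ [])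

    firstTarget-value : ∀ {e k n t m x} → action e k n t ≡ suc m → (∀ {i} → i < t → action e k n i ≡ 0) →
                        Eval ⊥-elim firstTarget (⟪ e , ⟪ k , n ⟫ ⟫ ∷ x ∷ []) m
    firstTarget-value {e} {k} {n} {t} {m} {x} now before =
      ev-comp (ev-mu (subst (Eval ⊥-elim (code idleF) (t ∷ u ∷ x ∷ [])) busy (correct idleF _))
                     (λ {i} i<t → 0 , subst (Eval ⊥-elim (code idleF) (i ∷ u ∷ x ∷ [])) (idle i<t) (correct idleF _))
               ∷ ev-proj ∷ [])
              (subst (Eval ⊥-elim (code targetF) (t ∷ u ∷ [])) target (correct targetF _))
      where
      u : ℕ
      u = ⟪ e , ⟪ k , n ⟫ ⟫
      busy : fun idleF (t ∷ u ∷ x ∷ []) ≡ 0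
      busy = cong (λ r → if0 r 1 0) (trans (codedActionF-value t e k n) now)
      idle : ∀ {i} → i < t → fun idleF (i ∷ u ∷ x ∷ []) ≡ 1
      idle {i} i<t = cong (λ r → if0 r 1 0) (trans (codedActionF-value i e k n) (before i<t))
      target : fun targetF (t ∷ u ∷ []) ≡ m
      target = cong pred (trans (codedActionF-value t e k n) now)

  -- The functions `f k` by the recursion theorem

  fixF : Total 1
  fixF = proj₁ (recursion (simulate firstTarget))

  opaque
    -- With `⟪ k , n ⟫` as parameter, the program for `f k n` knows `k`, `n` and its own index, and
    -- can therefore approximate `δ (f k n)`.
    f : ℕ → ℕ → ℕ
    f k n = fun fixF [ ⟪ k , n ⟫ ]

    f-computable : ∀ k → Computable (f k)
    f-computable k = Total⇒Computable (call fixF (pairF (lit k) (var zero) ◂ ε))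

    W-f : ∀ {k n t m} → action (f k n) k n t ≡ suc m → (∀ {i} → i < t → action (f k n) k n i ≡ 0) →
          W φ (f k n) ≐ W φ m
    W-f {k} {n} {t} {m} now before =
      (λ { {x} (y , p) → y , Equivalence.to (same x y) p }) ,
      (λ { {x} (y , p) → y , Equivalence.from (same x y) p })
      where
      same : ∀ x y → φ (f k n) ⟨ x ⟩≃ y ⇔ φ m ⟨ x ⟩≃ y
      same x y = ⇔-trans (proj₂ (recursion (simulate firstTarget)) ⟪ k , n ⟫ x y)
                         (simulate-correct firstTarget (firstTarget-value now before))

  -- Certificates for `k ∉ K`

  record Certificate (k n b s : ℕ) : Set where
    field
      bound   : b ≤ s
      -- This makes the computation in `defined` correct for `A`. It is the only clause whose
      -- verification needs the oracle.
      settled : Settled b s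
      defined : δAt b s (f k n) ≢ 0
      quiet   : ∀ {t} → t ≤ s → action (f k n) k n t ≡ 0

  open Certificate

  action-positive : ∀ e k n t {m} → action e k n t ≡ suc m →
    (ψAt (ψTime t n) n ≡ suc m × δAt (ψTime t n) t e ≡ 0) ⊎ (K k × δAt t t e ≡ suc m)
  action-positive e k n t eq
    with select-positive (ψAt (ψTime t n) n) _ _ (trans (sym (action-select e k n t)) eq)
  ... | inj₁ copyψ = inj₁ copyψ
  ... | inj₂ copyδ = let h , eq′ = if0-positive {halt t k} copyδ in inj₂ (halt-sound t k h , eq′)

  action-zero : ∀ e k n t → action e k n t ≡ 0 →
    if0 (halt t k) 0 (δAt t t e) ≡ 0 × (ψAt (ψTime t n) n ≢ 0 → δAt (ψTime t n) t e ≢ 0)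
  action-zero e k n t eq =
    select-zero (ψAt (ψTime t n) n) _ _ (trans (sym (action-select e k n t)) eq)

  firstAction : ∀ e k n {t} → action e k n t ≢ 0 →
                ∃ λ t₀ → (∃ λ m → action e k n t₀ ≡ suc m) × (∀ {i} → i < t₀ → action e k n i ≡ 0)
  firstAction e k n {t} act =
    search (action e k n) t , ≢0⇒suc (search-hit (action e k n) act) , search-below (action e k n) t

  -- Besides copying `W (δ e)`, the first action after `s` might copy `W (ψ n)`; a computation of
  -- `δ e` present at `s` still blocks this.
  certificate⇒∉K : ∀ {k n b s} → Certificate k n b s → ¬ K k
  certificate⇒∉K {k} {n} {b} {s} cert k∈K
    with ≢0⇒suc (defined cert) | halt-complete k∈K
  ... | d , δ≡d | κ , halts = refute (firstAction e k n acts)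
    where
    e t : ℕ
    e = f k n
    -- By this stage `k` has entered `K` and the certified computation is still present, so an
    -- action has occurred.
    t = κ ⊔ s
    acts : action e k n t ≢ 0
    acts act≡0 = suc⇒≢0 (δAt-mono (≤-trans (bound cert) (m≤n⊔m κ s)) (settled cert)
                                  (settled-mono (m≤n⊔m κ s) (settled cert)) δ≡d)
                        (if0-zero (halts (m≤m⊔n κ s)) (proj₁ (action-zero e k n t act≡0)))
    refute : ¬ ∃ λ t₀ → (∃ λ m → action e k n t₀ ≡ suc m) × (∀ {i} → i < t₀ → action e k n i ≡ 0)
    refute (t₀ , (m , now) , before) with action-positive e k n t₀ now
    ... | cases = refute-cases cases
      where
      s<t₀ : s < t₀
      s<t₀ = ≰⇒> λ t₀≤s → suc⇒≢0 now (quiet cert t₀≤s)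
      settled₀ : Settled b t₀
      settled₀ = settled-mono (<⇒≤ s<t₀) (settled cert)
      r : ℕ
      r = ψTime t₀ n
      refute-cases : ¬ ((ψAt r n ≡ suc m × δAt r t₀ e ≡ 0) ⊎ (K k × δAt t₀ t₀ e ≡ suc m))
      -- The approximation used at `t₀` is already the true value of `δ e`, so `W e` equals
      -- `W (δ e)`.
      refute-cases (inj₂ (_ , δ≡m)) with refl ← trans (sym δ≡m)
        (δAt-mono (≤-trans (bound cert) (<⇒≤ s<t₀)) (settled cert) settled₀ δ≡d) =
        δ-fpf e m (δAt-sound (settled cert) δ≡d) (proj₂ W≐ , proj₁ W≐)
        where
        W≐ : W φ e ≐ W φ m
        W≐ = W-f now before
      refute-cases (inj₁ (ψ≡m , δ≡0)) with <-≤-connex r b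
      -- The certified computation is also found with the larger bound `r`, and blocks the copying.
      ... | inj₂ b≤r = suc⇒≢0 (δAt-mono b≤r (settled cert) settled₀ δ≡d) δ≡0
      -- Here `ψ n` had halted before `s`. As nothing was copied at `s`, a computation with bound
      -- `r` was present then, and `A` no longer changes below `r`.
      ... | inj₁ r<b = suc⇒≢0 (δAt-mono ≤-refl (settled-antitone (<⇒≤ r<b) (settled cert))
                                (settled-antitone (<⇒≤ r<b) settled₀) (proj₂ (≢0⇒suc δ-defined))) δ≡0
        where
        same-time : ψTime s n ≡ r
        same-time = search-least (λ i → ψAt i n) (≤-trans (<⇒≤ r<b) (bound cert)) (suc⇒≢0 ψ≡m)
                                 (search-below (λ i → ψAt i n) t₀)
        δ-defined : δAt r s e ≢ 0
        δ-defined = subst (λ r → ψAt r n ≢ 0 → δAt r s e ≢ 0) same-time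
                          (proj₂ (action-zero e k n s (quiet cert ≤-refl))) (suc⇒≢0 ψ≡m)

  -- Correctness of `f k` in the absence of certificates

  Correct : (ℕ → ℕ) → Set
  Correct g = ∀ n → (∀ m → ψ ⟨ n ⟩≃ m → W φ (g n) ≐ W φ m) × (ψ ⟨ n ⟩↑ → δ ⟨ g n ⟩↑)

  -- As `k ∉ K`, every action copies `W (ψ n)`. A failure would be either inactivity although `ψ n`
  -- converges, or convergence of `δ e` although `ψ n` diverges; each yields a certificate.
  uncertified⇒correct : ∀ {k} → ¬ K k → (∀ n b s → ¬ Certificate k n b s) → Correct (f k)
  uncertified⇒correct {k} k∉K uncertified n = converges , diverges
    where
    e : ℕ
    e = f k n

    converges : ∀ m → ψ ⟨ n ⟩≃ m → W φ e ≐ W φ m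
    converges m p with ψAt-complete p
    ... | t₁ , ψ≡m with em {∃ λ t → action e k n t ≢ 0}
    ... | yes (t , act) = copies (firstAction e k n act)
      where
      copies : (∃ λ t₀ → (∃ λ m → action e k n t₀ ≡ suc m) × (∀ {i} → i < t₀ → action e k n i ≡ 0)) →
               W φ e ≐ W φ m
      copies (t₀ , (m′ , now) , before) with action-positive e k n t₀ now
      ... | inj₂ (k∈K , _) = contradiction k∈K k∉K
      ... | inj₁ (ψ≡m′ , _) = subst (λ m → W φ e ≐ W φ m)
        (functional ψ {[ n ]} (ψAt-sound (ψTime t₀ n) n ψ≡m′) p)
        (W-f now before)
    ... | no inactive = contradiction certificate (uncertified n r t)
      where
      r t : ℕ
      r = ψTime t₁ n
      -- Beyond the halting time `r`, with `A` settled below `r`: the computation that blocks `ψ n`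
      -- at this stage is correct.
      t = r ⊔ proj₁ (eventually-settled r)
      r≤t : r ≤ t
      r≤t = m≤m⊔n r _
      idle : ∀ t → action e k n t ≡ 0
      idle t with action e k n t in eq
      ... | zero  = refl
      ... | suc _ = contradiction (t , suc⇒≢0 eq) inactive
      halted : ψAt r n ≢ 0
      halted = search-hit (λ i → ψAt i n) (suc⇒≢0 (ψ≡m ≤-refl))
      same-time : ψTime t n ≡ r
      same-time = search-least (λ i → ψAt i n) r≤t halted (search-below (λ i → ψAt i n) t₁)
      certificate : Certificate k n r t
      certificate = record
        { bound   = r≤t
        ; settled = proj₂ (eventually-settled r) (m≤n⊔m r _)
        ; defined = subst (λ r → ψAt r n ≢ 0 → δAt r t e ≢ 0) same-time
                          (proj₂ (action-zero e k n t (idle t))) halted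
        ; quiet   = λ {i} _ → idle i
        }

    diverges : ψ ⟨ n ⟩↑ → δ ⟨ e ⟩↑
    diverges ψ↑ (d , p) with δAt-complete p
    -- With `ψ n` divergent and `k ∉ K` no stage acts, so the true computation of `δ e` is a
    -- certificate once `A` has settled below its bound.
    ... | b , δ≡d = uncertified n b s record
      { bound   = m≤m⊔n b _
      ; settled = settled-b
      ; defined = suc⇒≢0 (δ≡d ≤-refl s settled-b)
      ; quiet   = λ {i} _ → idle i
      }
      where
      s : ℕ
      s = b ⊔ proj₁ (eventually-settled b)
      settled-b : Settled b s
      settled-b = proj₂ (eventually-settled b) (m≤n⊔m b _)
      idle : ∀ t → action e k n t ≡ 0
      idle t with action e k n t in eq
      ... | zero  = refl
      ... | suc m with action-positive e k n t eq
      ...   | inj₁ (ψ≡m , _) = contradiction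
        (m , ψAt-sound (ψTime t n) n ψ≡m) ψ↑
      ...   | inj₂ (k∈K , _) = contradiction k∈K k∉K

  -- Deciding `K` from `A`

  charF : Fn (λ (_ : ⊤) → A) 1
  charF = record
    -- The values exist by excluded middle; the program obtains them from the oracle.
    { fun     = λ { (x ∷ []) → proj₁ (char A x) }
    ; code    = query tt
    ; correct = λ { (x ∷ []) → ev-query (proj₂ (char A x)) }
    }

  -- Nonzero exactly at the elements of `A` not yet enumerated, which turns `Settled` into a bounded
  -- search relative to `A`.
  missing : ℕ → ℕ → ℕ
  missing s x = proj₁ (char A x) ∸ approx s x

  settled⇒¬missing : ∀ {b s x} → Settled b s → x < b → missing s x ≡ 0
  settled⇒¬missing {x = x} settled x<b
    rewrite settled-char settled x<b (proj₂ (char A x)) = n∸n≡0 (proj₁ (char A x))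

  ¬missing⇒settled : ∀ {b s} → (∀ {x} → x < b → missing s x ≡ 0) → Settled b s
  ¬missing⇒settled {s = s} none {x} x<b x∈A with char A x | none x<b
  ... | _ , outside x∉A | _     = contradiction x∈A x∉A
  ... | _ , inside _    | 1∸≡0  = ≤-antisym (approx-≤1 s x) (m∸n≡0⇒m≤n 1∸≡0)

  -- 0 if k ∈ K at stage z, or if (n , b , s) is a certificate for k.
  check : ℕ → ℕ → ℕ → ℕ → ℕ → ℕ
  check k z n b s = if0 (halt z k) (if0 (δAt b s e) 1 (if0 (act (search act s)) (b ∸ search (missing s) b) 1)) 0
    where
    e = f k n
    act = action e k n

  -- Quietness includes stage `s`, so it is tested by the value of `act` at the search result.
  -- Settledness concerns only `x < b`, so it suffices that the search runs up to `b`.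
  check-sound : ∀ k z n b s → b ≤ s → check k z n b s ≡ 0 → halt z k ≢ 0 ⊎ Certificate k n b s
  check-sound k z n b s b≤s eq with halt z k
  ... | suc _ = inj₁ 1+n≢0
  ... | zero with δAt b s (f k n) in δ-eq
  ...   | suc _ with action (f k n) k n (search (action (f k n) k n) s) in quiet-eq
  ...     | zero = inj₂ record
    { bound   = b≤s
    ; settled = ¬missing⇒settled λ x<b →
                  search-below (missing s) b (<-≤-trans x<b (m∸n≡0⇒m≤n eq))
    ; defined = suc⇒≢0 δ-eq
    ; quiet   = search-none (action (f k n) k n) s quiet-eq
    }

  check-halt : ∀ k z n b s → halt z k ≢ 0 → check k z n b s ≡ 0
  check-halt k z n b s h with halt z k
  ... | zero  = contradiction refl h
  ... | suc _ = refl

  check-certificate : ∀ k z n b s → Certificate k n b s → check k z n b s ≡ 0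
  check-certificate k z n b s cert with halt z k
  ... | suc _ = refl
  ... | zero with δAt b s (f k n) in δ-eq
  ...   | zero  = contradiction δ-eq (defined cert)
  ...   | suc _ rewrite quiet cert (search-≤ (action (f k n) k n) s) = m≤n⇒m∸n≡0 all-present
    where
    all-present : b ≤ search (missing s) b
    all-present = ≮⇒≥ λ r<b →
      search-found (missing s) b r<b (settled⇒¬missing (settled cert) r<b)

  -- `z` codes `n`, `b` and the difference `s ∸ b`, which guarantees `b ≤ s`; it also serves as the
  -- stage for the enumeration of `K`.
  verify : ℕ → ℕ → ℕ
  verify k z = check k z (π₁ z) (π₁ (π₂ z)) (π₁ (π₂ z) + π₂ (π₂ z))

  opaque
    unfolding halt approx δAt action f

    verifyF : Fn (λ (_ : ⊤) → A) 2
    verifyF = if0F (call (relativizeFn haltF) (var (# 0) ◂ var (# 1) ◂ ε))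
      (if0F (call (relativizeFn (stage δ-code)) (b ◂ s ◂ e ◂ ε)) (lit 1)
        (if0F (call actF (searchF actF s ◂ all)) (b ∸F searchF missingF b) (lit 1)))
      (lit 0)
      where
      n b s e : Fn (λ (_ : ⊤) → A) 2
      n = π₁F (var (# 0))
      b = π₁F (π₂F (var (# 0)))
      s = b +F π₂F (π₂F (var (# 0)))
      e = call (relativizeFn fixF) (pairF (var (# 1)) n ◂ ε)
      actF missingF : Fn (λ (_ : ⊤) → A) 3
      actF = call (relativizeFn actionF) (var (# 0) ◂ call e (from 1) ◂ var (# 2) ◂ call n (from 1) ◂ ε)
      missingF = call charF (var (# 0) ◂ ε) ∸F
                 call (relativizeFn approxF) (call s (from 1) ◂ var (# 0) ◂ ε)

    verifyF-value : ∀ z k → fun verifyF (z ∷ k ∷ []) ≡ verify k z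
    verifyF-value z k = refl

    answerF : Fn (λ (_ : ⊤) → A) 2
    answerF = if0F (relativizeFn haltF) (lit 0) (lit 1)

    answerF-value : ∀ z k → fun answerF (z ∷ k ∷ []) ≡ if0 (halt z k) 0 1
    answerF-value z k = refl

  -- The oracle program looks for the least `z` that shows either `k ∈ K` or a certificate. One
  -- exists in both cases, and since certificates are sound, `halt z k` gives the answer.
  certified⇒K≤TA : (∀ k → ¬ K k → ∃ λ n → ∃ λ b → ∃ λ s → Certificate k n b s) → K ≤T A
  certified⇒K≤TA certified = K-code , λ { (k ∷ []) v → mk⇔ decides (decides⁻¹ k) }
    where
    K-code : Code ⊤ 1
    K-code = comp (code answerF) (mu (code verifyF) ∷ proj zero ∷ [])

    verified : ∀ {k v} → CharGraph K k v → ∃ λ z → verify k z ≡ 0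
    verified {k} (inside k∈K) with halt-complete k∈K
    -- Whatever triple the halting stage `z` happens to code, `check` accepts it.
    ... | z , h = z , check-halt k z _ _ _ (h ≤-refl)
    verified {k} (outside k∉K) with certified k k∉K
    ... | n , b , s , cert = z , (begin
      check k z (π₁ z) (π₁ (π₂ z)) (π₁ (π₂ z) + π₂ (π₂ z)) ≡⟨ cong checkVec (unpair n b (s ∸ b)) ⟩
      check k z n b (b + (s ∸ b))                         ≡⟨ cong (check k z n b) (m+[n∸m]≡n (bound cert)) ⟩
      check k z n b s                                     ≡⟨ check-certificate k z n b s cert ⟩
      0                                                   ∎)
      where
      open ≡-Reasoning
      z : ℕ
      z = ⟪ n , ⟪ b , s ∸ b ⟫ ⟫
      checkVec : Vec ℕ 3 → ℕ
      checkVec (n ∷ b ∷ c ∷ []) = check k z n b (b + c)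

    answer : ∀ {k v z} → CharGraph K k v → verify k z ≡ 0 → if0 (halt z k) 0 1 ≡ v
    answer {k} {z = z} (outside k∉K) _ with halt z k in eq
    ... | zero  = refl
    ... | suc _ = contradiction (halt-sound z k (suc⇒≢0 eq)) k∉K
    answer {k} {z = z} (inside k∈K) ok with check-sound k z _ _ _ (m≤m+n _ (π₂ (π₂ z))) ok
    ... | inj₂ cert = contradiction k∈K (certificate⇒∉K cert)
    ... | inj₁ h with halt z k
    ...   | zero  = contradiction refl h
    ...   | suc _ = refl

    decides : ∀ {k v} → CharGraph K k v → Eval (λ _ → A) K-code [ k ] v
    decides {k} {v} p =
      ev-comp (ev-mu (verify-Eval found) (λ i<z → let r , eq = ≢0⇒suc (earlier i<z) in r , verify-Eval eq)
               ∷ ev-proj ∷ [])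
              (subst (Eval _ (code answerF) (z ∷ k ∷ [])) (trans (answerF-value z k) (answer p found))
                     (correct answerF _))
      where
      -- `search` looks for nonzero values, so zero and nonzero are exchanged to find the least zero
      -- of `verify k`.
      failed : ℕ → ℕ
      failed i = if0 (verify k i) 1 0
      z : ℕ
      z = search failed (proj₁ (verified p))
      failed≢0 : ∀ {i} → verify k i ≡ 0 → failed i ≢ 0
      failed≢0 eq rewrite eq = 1+n≢0
      verify≡0 : ∀ i → failed i ≢ 0 → verify k i ≡ 0
      verify≡0 i h with verify k i
      ... | zero  = refl
      ... | suc _ = contradiction refl h
      found : verify k z ≡ 0
      found = verify≡0 z (search-hit failed (failed≢0 (proj₂ (verified p))))
      earlier : ∀ {i} → i < z → verify k i ≢ 0
      earlier i<z eq = failed≢0 eq (search-below failed (proj₁ (verified p)) i<z)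
      verify-Eval : ∀ {i r} → verify k i ≡ r → Eval (λ _ → A) (code verifyF) (i ∷ k ∷ []) r
      verify-Eval {i} eq = subst (Eval _ (code verifyF) _) (trans (verifyF-value i k) eq) (correct verifyF _)

    -- Follows from `decides`, because `K` has a characteristic value at `k` and evaluation is
    -- deterministic.
    decides⁻¹ : ∀ k {v} → Eval (λ _ → A) K-code [ k ] v → CharGraph K k v
    decides⁻¹ k p = let v , q = char K k in
      subst (CharGraph K k) (Eval-functional K-code (decides q) p) q

  -- The choice of `k` is not effective: if no `k ∉ K` were free of certificates, `K` would be
  -- reducible to `A`, and excluded middle then supplies one.
  solution : A <T K → ∃ λ (g : ℕ → ℕ) → Computable g × Correct g
  solution (_ , K≰A) with em {∃ λ k → ¬ K k × (∀ n b s → ¬ Certificate k n b s)}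
  ... | yes (k , k∉K , uncertified) = f k , f-computable k , uncertified⇒correct k∉K uncertified
  ... | no  none = contradiction (certified⇒K≤TA certified) K≰A
    where
    certified : ∀ k → ¬ K k → ∃ λ n → ∃ λ b → ∃ λ s → Certificate k n b s
    certified k k∉K with em {∃ λ n → ∃ λ b → ∃ λ s → Certificate k n b s}
    ... | yes cert = cert
    ... | no  ¬cert = contradiction (k , k∉K , λ n b s cert → ¬cert (n , b , s , cert)) none

theorem5p1 : ExcludedMiddle 0ℓ →
    (φ : Numbering) → Acceptable φ →
    (A : Pred ℕ 0ℓ) → ComputablyEnumerable φ A → A <T ∅′ φ →
    (δ : Partial 1) → PartialComputableIn A δ → FixedPointFree φ δ →
    (ψ : Partial 1) → PartialComputable ψ →
    ∃ λ (f : ℕ → ℕ) → Computable f ×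
    (∀ n → (∀ m → ψ ⟨ n ⟩≃ m → W φ (f n) ≐ W φ m) ×
    (ψ ⟨ n ⟩↑ → δ ⟨ f n ⟩↑))
theorem5p1 em φ acceptable A (a , A≐Wa) A<∅′ δ (δ-code , δ-correct) fpf ψ (ψ-code , ψ-correct) =
  Construction.solution em φ acceptable A a A≐Wa δ δ-code δ-correct fpf ψ ψ-code ψ-correct A<∅′
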